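{- Let $0\le i\le N$ and $1\le j\le N$. Node $n_i$ is forward-connected to node $n_j$ if and only if $i<j$ and there exist an integer $p\ge 0$ and indices $k_1,\dots,k_p$ with $i<k_1<k_2<\dots<k_p<j$ such that $$C^{\mathbf{A}}_{k_1}+C^{\mathbf{A}}_{k_2}+\cdots+C^{\mathbf{A}}_{k_p}+C^{\mathbf{A}}_j=X_j^N-X_i^N .$$ (When $p=0$ the left-hand side is just $C^{\mathbf{A}}_j$.)
   Context: Let $G$ be a finite tree (connected acyclic simple graph) with nodes $n_0,n_1,\dots,n_N$, $N\ge 1$, where $n_0$ is a terminal node (degree one) and the nodes are indexed so that along the path in $G$ from $n_0$ to any node $n_i$ the successively encountered node indices strictly increase. Node $n_i$ is forward-adjacent to $n_k$ if $n_i$ and $n_k$ are adjacent and $i<k$. Node $n_i$ is forward-connected to $n_j$ ($i<j$ necessarily) if there is a sequence of nodes $n_i=n_{l_0},n_{l_1},\dots,n_{l_m}=n_j$ with $m\ge 1$ in which each $n_{l_t}$ is forward-adjacent to $n_{l_{t+1}}$. The forward adjacency matrix $\mathbf{A}$ of $G$ is the $N\times N$ matrix, with rows and columns indexed by $1,\dots,N$, given by $\mathbf{A}(i,j)=1$ if $i=j$, $\mathbf{A}(i,j)=-1$ if $n_i$ is forward-adjacent to $n_j$, and $\mathbf{A}(i,j)=0$ otherwise. $C^{\mathbf{Q}}_j$ denotes the $j$-th column of a matrix $\mathbf{Q}$. For $1\le i\le N$, $X_i^N$ is the $N$-dimensional column vector with $1$ as its $i$-th entry and zeros elsewhere; $X_0^N$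 is the $N$-dimensional zero vector. -}

module Defs where

open import Data.Bool using (if_then_else_)
open import Data.Fin using (Fin; zero; suc; _<_)
open import Data.Fin.Properties using (_≟_; _<?_)
open import Data.Integer using (ℤ; 0ℤ; 1ℤ; -1ℤ) renaming (_+_ to _+ℤ_; _-_ to _-ℤ_)
open import Data.List using (List; []; _∷_; length; filter; allFin; foldr)
open import Data.List.Relation.Unary.Linked using (Linked)
open import Data.List.Relation.Unary.Unique.Propositional using (Unique)
open import Data.Nat using (ℕ; suc; _≤_)
open import Data.Product using (_×_)
open import Data.Vec.Functional using (Vector; zipWith; replicate)
open import Level using (0ℓ)
open import Relation.Binary using (Rel; Decidable; Symmetric)
open import Relation.Binary.Construct.Closure.Transitive using (TransClosure)
open import Relation.Binary.PropositionalEquality using (_≡_)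
open import Relation.Nullary using (¬_; does)
open import Relation.Nullary.Decidable using (_×-dec_)

-- Adjacency is decidable, as it is classically for every finite graph; this is
-- what allows degrees and the entries of the forward adjacency matrix to be computed.
record SimpleGraph (n : ℕ) : Set₁ where
  field
    Adj    : Rel (Fin n) 0ℓ
    adj?   : Decidable Adj
    sym    : Symmetric Adj
    irrefl : ∀ v → ¬ Adj v v

module _ {n : ℕ} (G : SimpleGraph n) where
  open SimpleGraph G

  data Walk : Fin n → Fin n → Set where
    stop : ∀ {u} → Walk u u
    step : ∀ {u v w} → Adj u v → Walk v w → Walk u w

  vertices : ∀ {u v} → Walk u v → List (Fin n)
  vertices {u} stop       = u ∷ []
  vertices {u} (step _ p) = u ∷ vertices p

  IsPath : ∀ {u v} → Walk u v → Set
  IsPath p = Unique (vertices p)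

  Connected : Set
  Connected = ∀ u v → Walk u v

  -- A cycle is a path on at least three vertices together with an edge joining
  -- its last vertex to its first.
  Acyclic : Set
  Acyclic = ∀ {u v} (p : Walk u v) → IsPath p → 3 ≤ length (vertices p) → ¬ Adj v u

  IsTree : Set
  IsTree = Connected × Acyclic

  degree : Fin n → ℕ
  degree v = length (filter (adj? v) (allFin n))

  Terminal : Fin n → Set
  Terminal v = degree v ≡ 1

  IncreasingFrom : Fin n → Set
  IncreasingFrom r = ∀ {v} (p : Walk r v) → IsPath p → Linked _<_ (vertices p)

  ForwardAdjacent : Rel (Fin n) 0ℓ
  ForwardAdjacent i k = Adj i k × i < k

  forwardAdjacent? : Decidable ForwardAdjacent
  forwardAdjacent? i k = adj? i k ×-dec (i <? k)

  -- The transitive closure consists of the chains with at least one step.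
  ForwardConnected : Rel (Fin n) 0ℓ
  ForwardConnected = TransClosure ForwardAdjacent

Matrix : ℕ → ℕ → Set
Matrix m n = Fin m → Fin n → ℤ

col : ∀ {m n} → Matrix m n → Fin n → Vector ℤ m
col Q j i = Q i j

infixl 6 _+ᵛ_ _-ᵛ_

_+ᵛ_ : ∀ {m} → Vector ℤ m → Vector ℤ m → Vector ℤ m
_+ᵛ_ = zipWith _+ℤ_

_-ᵛ_ : ∀ {m} → Vector ℤ m → Vector ℤ m → Vector ℤ m
_-ᵛ_ = zipWith _-ℤ_

0ᵛ : ∀ {m} → Vector ℤ m
0ᵛ = replicate _ 0ℤ

sumᵛ : ∀ {m} → List (Vector ℤ m) → Vector ℤ m
sumᵛ = foldr _+ᵛ_ 0ᵛ

-- Nodes n₀, …, n_N are the elements of Fin (suc N).  Rows and columns 1, …, N are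
-- the elements of Fin N, with k : Fin N standing for the index of the node suc k.
forwardAdjacencyMatrix : ∀ {N} → SimpleGraph (suc N) → Matrix N N
forwardAdjacencyMatrix G i j =
  if does (i ≟ j) then 1ℤ
  else if does (forwardAdjacent? G (suc i) (suc j)) then -1ℤ
  else 0ℤ

-- X zero is the zero vector; X (suc k) has its 1 in the entry k : Fin N, i.e. in
-- the row of the node suc k.
X : ∀ {N} → Fin (suc N) → Vector ℤ N
X zero    = 0ᵛ
X (suc i) = λ r → if does (r ≟ i) then 1ℤ else 0ℤ

{-# OPTIONS --safe #-}

-- Along paths from n₀ indices increase, which forces every node to be preceded by
-- at most one forward-adjacent node: if u ≠ w are both below v and adjacent to it, the
-- path n₀ … u v w would not be increasing unless w already lies on n₀ … u, so w ≤ u,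
-- and symmetrically u ≤ w.  Hence the column of v is X_v − X_u for the predecessor u
-- of v, and the columns along a forward chain telescope.
--
-- Conversely, n₀ is forward-connected to everything.  For i ≥ 1, let S be the set of
-- summed columns.  Row k of the sum counts k itself (if in S) minus its forward
-- neighbours in S; the prescribed values −1 for k = i and 0 for k ∈ S, k ≠ j, force such
-- a neighbour to exist in S.  Starting at i we climb inside S until j is reached.
module Submission where

open import Defs
open import Data.Bool using (if_then_else_)
open import Data.Fin using (Fin; zero; suc; _<_; _>_) renaming (_≤_ to _≤ᶠ_)
open import Data.Fin.Induction using (>-wellFounded)
open import Data.Fin.Properties using (_≟_; ≤-antisym; ≤-refl; <⇒≢; suc-injective)
open import Data.Integer using (ℤ; 0ℤ; 1ℤ; -1ℤ; -<+) renaming (_+_ to _+ℤ_; _-_ to _-ℤ_; _≤_ to _≤ℤ_; _<_ to _<ℤ_)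
open import Data.List using (List; []; map; _∷_; _++_; [_])
open import Data.List.Membership.Propositional using (_∈_; _∉_; find)
open import Data.List.Membership.Propositional.Properties using (∈-++⁻; ∈-map⁺)
open import Data.List.Relation.Unary.All using (All; []; _∷_; lookup)
open import Data.List.Relation.Unary.All.Properties using (¬Any⇒All¬)
open import Data.List.Relation.Unary.AllPairs as AllPairs using ([]; _∷_)
open import Data.List.Relation.Unary.Any using (here; there; any?)
open import Data.List.Relation.Unary.Linked as Linked using (Linked; [-]; _∷_)
open import Data.List.Relation.Unary.Linked.Properties using (Linked⇒AllPairs)
open import Data.List.Relation.Unary.Unique.Propositional using (Unique)
open import Data.List.Relation.Unary.Unique.Propositional.Properties using (++⁺)
open import Data.Nat using (ℕ; suc; _≤_; s<s⁻¹)
open import Data.Product using (_×_; Σ-syntax; ∃-syntax; _,_; proj₂)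
open import Data.Sum using (inj₁; inj₂)
open import Function.Base using (_∘_; case_of_)
open import Function.Bundles using (_⇔_; mk⇔)
open import Induction.WellFounded using (Acc; acc)
open import Relation.Binary.Construct.Closure.Transitive using (_∷_) renaming ([_] to [_]⁺)
open import Relation.Binary.PropositionalEquality using (_≡_; _≢_; _≗_; refl; sym; trans; cong; cong₂; subst)
open import Relation.Nullary using (¬_; Dec; does; yes; no; contradiction)
open import Relation.Nullary.Decidable using (dec-true; dec-false)
import Data.Integer.Properties as ℤ
import Data.Integer.Tactic.RingSolver as ℤ-Solver
import Data.List.Membership.DecPropositional as DecMembership
import Data.Nat.Properties as ℕ

module _ {a p} {A : Set a} {P : Set p} {x y : A} (P? : Dec P) where

  if-yes : P → (if does P? then x else y) ≡ x
  if-yes p = cong (if_then x else y) (dec-true P? p)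

  if-no : ¬ P → (if does P? then x else y) ≡ y
  if-no ¬p = cong (if_then x else y) (dec-false P? ¬p)

-- Walks, paths and predecessors in a graph with increasing labels.

module _ {n : ℕ} (G : SimpleGraph n) where
  open SimpleGraph G using (Adj)
  open DecMembership (_≟_ {n}) using (_∈?_)

  snoc : ∀ {u v w} → Walk G u v → Adj v w → Walk G u w
  snoc stop       vw = step vw stop
  snoc (step e p) vw = step e (snoc p vw)

  vertices-snoc : ∀ {u v w} (p : Walk G u v) (vw : Adj v w) →
                  vertices G (snoc p vw) ≡ vertices G p ++ [ w ]
  vertices-snoc stop       vw = refl
  vertices-snoc (step e p) vw = cong (_ ∷_) (vertices-snoc p vw)

  snoc-isPath : ∀ {u v w} (p : Walk G u v) (vw : Adj v w) →
                IsPath G p → w ∉ vertices G p → IsPath G (snoc p vw)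
  snoc-isPath p vw unique w∉p = subst Unique (sym (vertices-snoc p vw))
    (++⁺ unique ([] ∷ []) λ { (x∈p , here refl) → w∉p x∈p })

  ∉-snoc : ∀ {u v w x} (p : Walk G u v) (vw : Adj v w) →
           x ∉ vertices G p → x ≢ w → x ∉ vertices G (snoc p vw)
  ∉-snoc p vw x∉p x≢w x∈ with ∈-++⁻ (vertices G p) (subst (_ ∈_) (vertices-snoc p vw) x∈)
  ... | inj₁ x∈p        = x∉p x∈p
  ... | inj₂ (here x≡w) = x≢w x≡w

  suffix : ∀ {u v x} (p : Walk G u v) → IsPath G p → x ∈ vertices G p →
           Σ[ q ∈ Walk G x v ] IsPath G q
  suffix stop       unique       (here refl) = stop , unique
  suffix (step e p) unique       (here refl) = step e p , unique
  suffix (step e p) (_ ∷ unique) (there x∈p) = suffix p unique x∈p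

  -- Loop erasure from the far end: if the new first vertex already lies on the path built so far,
  -- everything before that occurrence is cut off.
  toPath : ∀ {u v} → Walk G u v → Σ[ p ∈ Walk G u v ] IsPath G p
  toPath stop = stop , [] ∷ []
  toPath {u} (step e p) with toPath p
  ... | q , unique with u ∈? vertices G q
  ...   | yes u∈q = suffix q unique u∈q
  ...   | no  u∉q = step e q , ¬Any⇒All¬ _ u∉q ∷ unique

  increasing⇒≤-end : ∀ {u v x} (p : Walk G u v) → Linked _<_ (vertices G p) →
                     x ∈ vertices G p → x ≤ᶠ v
  increasing⇒≤-end stop                p↑         (here refl) = ≤-refl
  increasing⇒≤-end (step e stop)       (lt ∷ p↑)  (here refl) = ℕ.<⇒≤ lt
  increasing⇒≤-end (step e (step f p)) (lt ∷ p↑)  (here refl) =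
    ℕ.<⇒≤ (ℕ.<-≤-trans lt (increasing⇒≤-end (step f p) p↑ (here refl)))
  increasing⇒≤-end (step e p)          p↑         (there x∈p) =
    increasing⇒≤-end p (Linked.tail p↑) x∈p

  increasing-snoc⇒< : ∀ {u v w} (p : Walk G u v) (vw : Adj v w) →
                      Linked _<_ (vertices G (snoc p vw)) → v < w
  increasing-snoc⇒< stop       vw p↑ = Linked.head p↑
  increasing-snoc⇒< (step e p) vw p↑ = increasing-snoc⇒< p vw (Linked.tail p↑)

  increasing⇒forwardConnected : ∀ {u v w} (e : Adj u v) (p : Walk G v w) →
    Linked _<_ (vertices G (step e p)) → ForwardConnected G u w
  increasing⇒forwardConnected e stop       (lt ∷ _)  = [ e , lt ]⁺
  increasing⇒forwardConnected e (step f p) (lt ∷ p↑) =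
    (e , lt) ∷ increasing⇒forwardConnected f p p↑

  forwardConnected⇒< : ∀ {u v} → ForwardConnected G u v → u < v
  forwardConnected⇒< [ _ , lt ]⁺      = lt
  forwardConnected⇒< ((_ , lt) ∷ vw) = ℕ.<-trans lt (forwardConnected⇒< vw)

  module _ {r : Fin n} (connected : Connected G) (increasing : IncreasingFrom G r) where

    predecessor-≤ : ∀ {u v w} → ForwardAdjacent G u v → ForwardAdjacent G w v → w ≤ᶠ u
    predecessor-≤ {u} {v} {w} (uv , u<v) (wv , w<v) with toPath (connected r u)
    ... | p , unique with w ∈? vertices G p
    ...   | yes w∈p = increasing⇒≤-end p (increasing p unique) w∈p
    ...   | no  w∉p = contradiction v<w (ℕ.<⇒≯ w<v)
      where
      v∉p : v ∉ vertices G p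
      -- The end `u` is the largest vertex of the increasing path `p`, and `v` lies above it.
      v∉p v∈p = ℕ.<⇒≱ u<v (increasing⇒≤-end p (increasing p unique) v∈p)

      vw = SimpleGraph.sym G wv

      v<w : v < w
      v<w = increasing-snoc⇒< (snoc p uv) vw (increasing (snoc (snoc p uv) vw)
              (snoc-isPath (snoc p uv) vw (snoc-isPath p uv unique v∉p)
                (∉-snoc p uv w∉p (<⇒≢ w<v))))

    predecessor-unique : ∀ {u v w} → ForwardAdjacent G u v → ForwardAdjacent G w v → u ≡ w
    predecessor-unique u→v w→v =
      ≤-antisym (predecessor-≤ w→v u→v) (predecessor-≤ u→v w→v)

    -- An increasing path from the root is itself a forward chain; `r ≢ v` ensures that it has a
    -- step.
    root-forwardConnected : ∀ {v} → r ≢ v → ForwardConnected G r v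
    root-forwardConnected {v} r≢v with toPath (connected r v)
    ... | stop     , _      = contradiction refl r≢v
    ... | step e p , unique = increasing⇒forwardConnected e p (increasing (step e p) unique)

-- Entries of the unit vectors and of the forward adjacency matrix.

X-diagonal : ∀ {N} (k : Fin N) → X (suc k) k ≡ 1ℤ
X-diagonal k = if-yes (k ≟ k) refl

X-off-diagonal : ∀ {N} {k : Fin N} {i} → i ≢ suc k → X i k ≡ 0ℤ
X-off-diagonal {i = zero}      i≢k = refl
X-off-diagonal {k = k} {suc i} i≢k = if-no (k ≟ i) λ k≡i → i≢k (cong suc (sym k≡i))

module _ {N : ℕ} (G : SimpleGraph (suc N)) where

  private
    A = forwardAdjacencyMatrix G

    _↝_ : Fin N → Fin N → Set
    k ↝ l = ForwardAdjacent G (suc k) (suc l)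

    _↝?_ : ∀ k l → Dec (k ↝ l)
    k ↝? l = forwardAdjacent? G (suc k) (suc l)

  A-diagonal : ∀ k → A k k ≡ 1ℤ
  A-diagonal k = if-yes (k ≟ k) refl

  A-forward : ∀ {k l} → k ↝ l → A k l ≡ -1ℤ
  A-forward {k} {l} k↝l =
    trans (if-no (k ≟ l) (<⇒≢ (proj₂ k↝l) ∘ cong suc)) (if-yes (k ↝? l) k↝l)

  A-otherwise : ∀ {k l} → k ≢ l → ¬ k ↝ l → A k l ≡ 0ℤ
  A-otherwise {k} {l} k≢l k↝̸l = trans (if-no (k ≟ l) k≢l) (if-no (k ↝? l) k↝̸l)

  0<A-diagonal : ∀ k → 0ℤ <ℤ A k k
  0<A-diagonal k = subst (0ℤ <ℤ_) (sym (A-diagonal k)) (ℤ.positive⁻¹ 1ℤ)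

  -- The negative entries of row `k` sit exactly at the forward neighbours of `k`.
  0≤A : ∀ {k l} → ¬ k ↝ l → 0ℤ ≤ℤ A k l
  0≤A {k} {l} k↝̸l = case k ≟ l of λ where
    (yes refl) → ℤ.<⇒≤ (0<A-diagonal k)
    (no k≢l)   → ℤ.≤-reflexive (sym (A-otherwise k≢l k↝̸l))

  -- From a column sum to a forward chain.

  columnSum : List (Fin N) → Fin N → ℤ
  columnSum S = sumᵛ (map (col A) S)

  0≤columnSum : ∀ {k S} → All (¬_ ∘ (k ↝_)) S → 0ℤ ≤ℤ columnSum S k
  0≤columnSum []             = ℤ.≤-refl
  0≤columnSum (k↝̸l ∷ k↝̸S) = ℤ.+-mono-≤ (0≤A k↝̸l) (0≤columnSum k↝̸S)

  0<columnSum : ∀ {k S} → All (¬_ ∘ (k ↝_)) S → k ∈ S → 0ℤ <ℤ columnSum S k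
  0<columnSum {k} (_ ∷ k↝̸S) (here refl) =
    ℤ.+-mono-<-≤ (0<A-diagonal k) (0≤columnSum k↝̸S)
  0<columnSum (k↝̸l ∷ k↝̸S) (there k∈S) = ℤ.+-mono-≤-< (0≤A k↝̸l) (0<columnSum k↝̸S k∈S)

  columnSum<0⇒successor : ∀ {k} S → columnSum S k <ℤ 0ℤ → ∃[ l ] l ∈ S × k ↝ l
  columnSum<0⇒successor {k} S sum<0 with any? (k ↝?_) S
  ... | yes k↝S = find k↝S
  ... | no  k↝̸S = contradiction (0≤columnSum (¬Any⇒All¬ S k↝̸S)) (ℤ.<⇒≱ sum<0)

  -- Column `k` itself contributes the diagonal 1 to row `k`, so even a zero row needs a negative
  -- entry to compensate.
  columnSum≤0⇒successor : ∀ {k} S → k ∈ S → columnSum S k ≤ℤ 0ℤ → ∃[ l ] l ∈ S × k ↝ l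
  columnSum≤0⇒successor {k} S k∈S sum≤0 with any? (k ↝?_) S
  ... | yes k↝S = find k↝S
  ... | no  k↝̸S = contradiction sum≤0 (ℤ.<⇒≱ (0<columnSum (¬Any⇒All¬ S k↝̸S) k∈S))

  columnSum⇒forwardConnected : ∀ {i j} S → (∀ {k} → k ∈ S → i < k) → i ≢ j →
    columnSum S ≗ X (suc j) -ᵛ X (suc i) → ForwardConnected G (suc i) (suc j)
  columnSum⇒forwardConnected {i} {j} S i<S i≢j sum≗ =
    let l , l∈S , i↝l = columnSum<0⇒successor S (subst (_<ℤ 0ℤ) (sym row-i) -<+)
    in extend i↝l l∈S (>-wellFounded l)
    where
    row-i : columnSum S i ≡ -1ℤ
    row-i = trans (sum≗ i)
      (cong₂ _-ℤ_ (X-off-diagonal (i≢j ∘ sym ∘ suc-injective)) (X-diagonal i))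

    row-k : ∀ {k} → k ∈ S → k ≢ j → columnSum S k ≡ 0ℤ
    row-k {k} k∈S k≢j = trans (sum≗ k)
      (cong₂ _-ℤ_ (X-off-diagonal (k≢j ∘ sym ∘ suc-injective))
                  (X-off-diagonal (<⇒≢ (i<S k∈S) ∘ suc-injective)))

    -- The edge from `h` to `k` is carried along so that the chain is never empty. Each forward step
    -- raises the index, so the climb is a well-founded recursion on `_>_` and can only end at `j`.
    extend : ∀ {h k} → h ↝ k → k ∈ S → Acc _>_ k → ForwardConnected G (suc h) (suc j)
    extend {k = k} h↝k k∈S (acc rec) with k ≟ j
    ... | yes refl = [ h↝k ]⁺
    ... | no  k≢j  =
      let l , l∈S , k↝l = columnSum≤0⇒successor S k∈S (ℤ.≤-reflexive (row-k k∈S k≢j))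
      in h↝k ∷ extend k↝l l∈S (rec (s<s⁻¹ (proj₂ k↝l)))

  -- From a forward chain to a column sum.

  module _ (connected : Connected G) (increasing : IncreasingFrom G zero) where

    column≗ : ∀ {i k} → ForwardAdjacent G i (suc k) → col A k ≗ X (suc k) -ᵛ X i
    column≗ {i} {k} i→k r = case (r ≟ k) , (i ≟ suc r) of λ where
      (yes refl , _) → trans (A-diagonal k)
        (sym (cong₂ _-ℤ_ (X-diagonal k) (X-off-diagonal (<⇒≢ (proj₂ i→k)))))
      (no r≢k , yes refl) → trans (A-forward i→k)
        (sym (cong₂ _-ℤ_ (X-off-diagonal (r≢k ∘ sym ∘ suc-injective)) (X-diagonal r)))
      -- An entry -1 here would make `suc r` a second predecessor of `suc k`. If `i` is the root,
      -- every row other than `k` falls in this case, in accordance with `X zero` being zero.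
      (no r≢k , no i≢r) → trans
        (A-otherwise r≢k (i≢r ∘ predecessor-unique G connected increasing i→k))
        (sym (cong₂ _-ℤ_ (X-off-diagonal (r≢k ∘ sym ∘ suc-injective)) (X-off-diagonal i≢r)))

    -- The list `ks` consists of the interior nodes of the chain; each column is the difference of
    -- the unit vectors at the two ends of one step.
    forwardConnected⇒columnSum : ∀ {i j} → ForwardConnected G i (suc j) →
      Σ[ ks ∈ List (Fin N) ] (Linked _<_ (i ∷ map suc (ks ++ [ j ])) ×
                              columnSum (ks ++ [ j ]) ≗ X (suc j) -ᵛ X i)
    forwardConnected⇒columnSum [ i→j ]⁺ =
      [] , proj₂ i→j ∷ [-] , λ r → trans (ℤ.+-identityʳ _) (column≗ i→j r)
    forwardConnected⇒columnSum {i} {j} (_∷_ {y = suc k} i→k k→⁺j) =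
      let ks , ks↑ , sum≗ = forwardConnected⇒columnSum k→⁺j
      in k ∷ ks , proj₂ i→k ∷ ks↑ , λ r →
           trans (cong₂ _+ℤ_ (column≗ i→k r) (sum≗ r)) (telescope (X (suc k) r) (X i r) (X (suc j) r))
      where
      telescope : ∀ x y z → (x -ℤ y) +ℤ (z -ℤ x) ≡ z -ℤ y
      telescope = ℤ-Solver.solve-∀

theorem4 : (N : ℕ) → 1 ≤ N →
    (G : SimpleGraph (suc N)) → IsTree G → Terminal G zero → IncreasingFrom G zero →
    let A = forwardAdjacencyMatrix G in
    (i : Fin (suc N)) (j : Fin N) →
    ForwardConnected G i (suc j) ⇔
    (i < suc j ×
    (Σ[ ks ∈ List (Fin N) ] (Linked _<_ (i ∷ map suc (ks ++ [ j ])) ×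
    sumᵛ (map (col A) (ks ++ [ j ])) ≗ X (suc j) -ᵛ X i)))
theorem4 N _ G (connected , _) _ increasing i j = mk⇔
  (λ i→⁺j → forwardConnected⇒< G i→⁺j , forwardConnected⇒columnSum G connected increasing i→⁺j)
  (λ (i<j , ks , ks↑ , sum≗) → from i i<j ks ks↑ sum≗)
  where
  from : ∀ i → i < suc j → ∀ ks → Linked _<_ (i ∷ map suc (ks ++ [ j ])) →
         columnSum G (ks ++ [ j ]) ≗ X (suc j) -ᵛ X i → ForwardConnected G i (suc j)
  -- The root has no row in the matrix to start the climb from, but it is forward-connected to every
  -- other node.
  from zero    _   _  _   _    = root-forwardConnected G connected increasing λ ()
  from (suc i) i<j ks ks↑ sum≗ =
    columnSum⇒forwardConnected G (ks ++ [ j ])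
      -- By transitivity, the head of the linked list lies below all later entries.
      (λ k∈S → s<s⁻¹ (lookup (AllPairs.head (Linked⇒AllPairs ℕ.<-trans ks↑)) (∈-map⁺ suc k∈S)))
      (<⇒≢ i<j ∘ cong suc) sum≗
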